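{- There exists a planar graph $G$ with $\operatorname{pn}_\ell(G) = 3$.
   Context: All graphs are finite and simple. A linear embedding of a graph $G=(V,E)$ is a pair $(\prec,\mathcal{P})$ where $\prec$ is a total order on $V$ and $\mathcal{P}$ is a partition of $E$ into parts called pages. Two edges $uv, xy$ with $u\prec v$, $x \prec y$ cross if $u \prec x \prec v \prec y$ or $x \prec u \prec y \prec v$. A linear embedding is a book embedding if no two crossing edges lie in the same page. For a book embedding and a vertex $v$, let $\mathcal{P}_v$ be the set of pages containing at least one edge incident to $v$; the embedding is $k$-local if $|\mathcal{P}_v|\le k$ for all $v$. The local page number $\operatorname{pn}_\ell(G)$ is the least $k$ such that $G$ has a $k$-local book embedding (with any number of pages). -}

module Defs where

open import Data.Nat using (ℕ; _<_; _≤_)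
open import Data.Fin using (Fin; toℕ)
open import Data.Bool using (Bool; T)
open import Data.List using (List; length)
open import Data.List.Membership.Propositional using (_∈_)
open import Data.Product using (Σ; _×_; _,_; ∃; proj₁; proj₂)
open import Data.Sum using (_⊎_)
open import Relation.Binary.PropositionalEquality using (_≡_; _≢_)
open import Relation.Nullary using (¬_)
open import Function.Definitions using (Injective)
open import Data.Rational as ℚ using (ℚ; 0ℚ; 1ℚ)

record Graph : Set where
  field
    n     : ℕ
    adj   : Fin n → Fin n → Bool
    sym   : ∀ u v → adj u v ≡ adj v u
    irrefl : ∀ v → adj v v ≡ Data.Bool.false

open Graph public

Edge : (G : Graph) → Fin (n G) → Fin (n G) → Set
Edge G u v = T (adj G u v)

-- A linear embedding: a total order on V, given by an injective position
-- map V → Fin n (u ≺ v iff pos u < pos v), and a partition of E into pages,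
-- given by a page label for each edge (labels in ℕ; any number of pages).
-- The page function is required to be symmetric on edges, so it is a
-- function on unordered edges.
record LinearEmbedding (G : Graph) : Set where
  field
    pos    : Fin (n G) → Fin (n G)
    pos-inj : Injective _≡_ _≡_ pos
    page   : Fin (n G) → Fin (n G) → ℕ
    page-sym : ∀ u v → Edge G u v → page u v ≡ page v u

open LinearEmbedding public

module _ {G : Graph} (L : LinearEmbedding G) where
  _≺_ : Fin (n G) → Fin (n G) → Set
  u ≺ v = toℕ (pos L u) < toℕ (pos L v)

  -- edges uv (u ≺ v) and xy (x ≺ y) cross via u ≺ x ≺ v ≺ y;
  -- the symmetric case is covered by swapping the roles of the edges.
  Crosses : Fin (n G) → Fin (n G) → Fin (n G) → Fin (n G) → Set
  Crosses u v x y = u ≺ x × x ≺ v × v ≺ y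

  IsBookEmbedding : Set
  IsBookEmbedding = ∀ u v x y → Edge G u v → Edge G x y →
    Crosses u v x y → page L u v ≢ page L x y

  IsLocal : ℕ → Set
  IsLocal k = ∀ v → Σ (List ℕ) λ ps → length ps ≤ k ×
    (∀ w → Edge G v w → page L v w ∈ ps)

HasLocalBookEmbedding : Graph → ℕ → Set
HasLocalBookEmbedding G k =
  Σ (LinearEmbedding G) λ L → IsBookEmbedding L × IsLocal L k

LocalPageNumber : Graph → ℕ → Set
LocalPageNumber G k = HasLocalBookEmbedding G k ×
  (∀ j → HasLocalBookEmbedding G j → k ≤ j)

-- Planarity (via straight-line drawings in ℚ², cf. Fáry's theorem)

Point : Set
Point = ℚ × ℚ

OnSegment : Point → Point → Point → Set
OnSegment p a b = Σ ℚ λ t → 0ℚ ℚ.≤ t × t ℚ.≤ 1ℚ ×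
  proj₁ p ≡ proj₁ a ℚ.+ t ℚ.* (proj₁ b ℚ.- proj₁ a) ×
  proj₂ p ≡ proj₂ a ℚ.+ t ℚ.* (proj₂ b ℚ.- proj₂ a)

module _ (G : Graph) (d : Fin (n G) → Point) where
  SameEdge : (u v x y : Fin (n G)) → Set
  SameEdge u v x y = (u ≡ x × v ≡ y) ⊎ (u ≡ y × v ≡ x)

  IsPlaneDrawing : Set
  IsPlaneDrawing =
    Injective _≡_ _≡_ d ×
    (∀ u v w → Edge G u v → OnSegment (d w) (d u) (d v) → (w ≡ u ⊎ w ≡ v)) ×
    (∀ u v x y p → Edge G u v → Edge G x y →
       OnSegment p (d u) (d v) → OnSegment p (d x) (d y) →
       SameEdge u v x y ⊎
       Σ (Fin (n G)) λ w → (w ≡ u ⊎ w ≡ v) × (w ≡ x ⊎ w ≡ y) × p ≡ d w)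

Planar : Graph → Set
Planar G = Σ (Fin (n G) → Point) λ d → IsPlaneDrawing G d

{-# OPTIONS --safe #-}
-- The graph is a K₄ (the core) with five "units" {x,y,s,t} on each of its edges pq: x and y are adjacent and see p, q, s, t,
-- while s sees p and t sees q.
--
-- In a 2-local book embedding some two core vertices p, q have all their edges on the same two pages: two core edges cross,
-- on pages α ≠ β, so the ends of one have page pairs {α,·} and the ends of the other {β,·}, and the four remaining core edges
-- force two of these four pairs to coincide.
-- On an arc between p and q, consider the common neighbours of p and q. If z precedes z′ then zq and pz′ cross, so a
-- neighbour with another one on each side has both of the two pages and no other, and cannot send an edge out of the arc. Hence a unit
-- whose x and y are surrounded in this way has s and t between x and y, which two pages do not allow. So each of the five
-- units contains the first or last common neighbour on one of the two arcs: a contradiction, as there are only four of these.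
--
-- For the upper bound put the core first and then unit after unit. Every core vertex keeps a page for its fan, and one
-- further page takes the edges inside units.
module Submission where

open import Defs hiding (sym)
open import Data.Bool using (Bool; true; false; T; not; _∧_; _∨_; if_then_else_)
open import Data.Bool.ListAction using (all)
open import Data.Bool.Properties using (∨-zeroʳ; T-∧; T-∨; T-≡)
open import Data.Empty using (⊥)
open import Data.Fin using (Fin; zero; suc; toℕ; splitAt; join; combine; remQuot)
open import Data.Fin.Patterns using (0F; 1F; 2F; 3F; 4F; 5F)
open import Data.Fin.Properties using (toℕ-injective; toℕ<n; pigeonhole; splitAt-↑ˡ; splitAt-↑ʳ;
  join-splitAt; combine-remQuot; remQuot-combine)
  renaming (any? to anyFin?; <⇒≢ to <ᶠ⇒≢; _≟_ to _≟ᶠ_)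
import Data.Integer as ℤ
import Data.Integer.Properties as ℤ
open import Data.List using (List; []; _∷_; _++_; length; map; filter; allFin; cartesianProduct)
open import Data.List.Membership.Propositional using (_∈_)
open import Data.List.Membership.Propositional.Properties using (∈-filter⁺; ∈-cartesianProduct⁺; ∈-allFin; ∈-map⁺; ∈-++⁺ˡ; ∈-++⁺ʳ)
open import Data.List.Relation.Unary.All using (lookup)
open import Data.List.Relation.Unary.All.Properties using (all⁺)
open import Data.List.Relation.Unary.Any using (here; there)
open import Data.Nat using (ℕ; _+_; _*_; _∸_; _≤_; _<_; _≟_; _<?_; _<ᵇ_; _≡ᵇ_; z≤n; s≤s)
open import Data.Nat.Coprimality using (1-coprimeTo) renaming (sym to coprime-sym)
open import Data.Nat.Properties using (≤-refl; ≤-trans; ≤-antisym; <-trans; <-≤-trans; <-irrefl; <-asym; <-cmp; <⇒≢;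
  ≮⇒≥; ≤∧≢⇒<; m≤n+m; +-monoˡ-<; +-cancelʳ-<; +-cancelʳ-≡; *-comm; <⇒<ᵇ; <ᵇ⇒<; ≡⇒≡ᵇ; ≡ᵇ⇒≡)
open import Data.Product using (Σ; _×_; _,_; ∃; ∃₂; proj₁; proj₂; map₁; uncurry)
open import Data.Rational as ℚ using (ℚ; 0ℚ; 1ℚ; mkℚ)
import Data.Rational.Properties as ℚ
open import Data.Rational.Solver using (module +-*-Solver)
import Data.Rational.Unnormalised as ℚᵘ
import Data.Rational.Unnormalised.Properties as ℚᵘ
open import Data.Sum using (_⊎_; inj₁; inj₂; map₂; swap)
open import Data.Sum.Properties using (inj₁-injective)
open import Data.Unit using (tt)
open import Function using (_∘_; id; Equivalence; mk⇔)
open import Relation.Binary.Definitions using (tri<; tri≈; tri>)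
open import Relation.Binary.PropositionalEquality using (_≡_; _≢_; refl; sym; trans; cong; cong₂; subst; subst₂; ≢-sym)
open import Relation.Nullary using (¬_; Dec; yes; no; does; contradiction; _×-dec_; _⊎-dec_)
open import Relation.Nullary.Decidable using (map′; dec-true; does-⇔; T?)

-- Pairs of pages, and book embeddings as abstract layouts.

_∈⟨_,_⟩ : ℕ → ℕ → ℕ → Set
k ∈⟨ a , c ⟩ = k ≡ a ⊎ k ≡ c

-- A pair of pages leaves a single value other than `i`. The crossing arguments on an arc use this
-- to identify two pages.
pair-squeeze : ∀ {a c i j k} → i ∈⟨ a , c ⟩ → j ∈⟨ a , c ⟩ → k ∈⟨ a , c ⟩ → i ≢ j → i ≢ k → j ≡ k
pair-squeeze (inj₁ refl) (inj₁ refl) _           i≢j _   = contradiction refl i≢j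
pair-squeeze (inj₁ refl) (inj₂ refl) (inj₁ refl) _   i≢k = contradiction refl i≢k
pair-squeeze (inj₁ refl) (inj₂ refl) (inj₂ refl) _   _   = refl
pair-squeeze (inj₂ refl) (inj₁ refl) (inj₁ refl) _   _   = refl
pair-squeeze (inj₂ refl) (inj₁ refl) (inj₂ refl) _   i≢k = contradiction refl i≢k
pair-squeeze (inj₂ refl) (inj₂ refl) _           i≢j _   = contradiction refl i≢j

-- Keys are arbitrary distinct naturals instead of positions, so that a rotation of the spine, which
-- raises some keys by a constant, yields a layout again.
record Layout : Set₁ where
  field
    V        : Set
    E        : V → V → Set
    E-sym    : ∀ {u v} → E u v → E v u
    E-irrefl : ∀ {v} → ¬ E v v
    pg       : V → V → ℕ
    pg-sym   : ∀ {u v} → E u v → pg u v ≡ pg v u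
    key      : V → ℕ
    key-inj  : ∀ {u v} → key u ≡ key v → u ≡ v
    cross    : ∀ {u v x y} → key u < key x → key x < key v → key v < key y →
               E u v → E x y → pg u v ≢ pg x y

  E⇒≢ : ∀ {u v} → E u v → u ≢ v
  E⇒≢ e refl = E-irrefl e

  On : ℕ → ℕ → V → Set
  On a c v = ∀ {w} → E v w → pg v w ∈⟨ a , c ⟩

  TwoLocal : Set
  TwoLocal = ∀ v → ∃₂ λ a c → On a c v

  Twin : V → V → Set
  Twin u v = ∃₂ λ a c → On a c u × On a c v

  on-sym : ∀ {a c v w} → On a c v → E v w → pg w v ∈⟨ a , c ⟩
  on-sym on e = subst (_∈⟨ _ , _ ⟩) (pg-sym e) (on e)

  -- The edges `vu` and `vw` exhaust the two pages of `v`, so a pair containing both of their pages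
  -- contains every page at `v`.
  on-absorb : TwoLocal → ∀ {a c v u w} → E v u → E v w → pg v u ≢ pg v w →
              pg v u ∈⟨ a , c ⟩ → pg v w ∈⟨ a , c ⟩ → On a c v
  on-absorb local {v = v} {u} {w} vu vw u≢w ∈u ∈w {z} vz with local v
  ... | _ , _ , on with pg v u ≟ pg v z
  ...   | yes eq = subst (_∈⟨ _ , _ ⟩) eq ∈u
  ...   | no u≢z = subst (_∈⟨ _ , _ ⟩) (pair-squeeze (on vu) (on vw) (on vz) u≢w u≢z) ∈w

  -- Pairs are unordered, so the page of a chosen edge can be named first. In the study of four
  -- vertices only the second entries then remain unknown.
  on-normaliseˡ : TwoLocal → ∀ {v w} → E v w → ∃ λ c → On (pg v w) c v
  on-normaliseˡ local {v} e with local v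
  ... | a , c , on with on e
  ...   | inj₁ refl = c , on
  ...   | inj₂ refl = a , λ e′ → swap (on e′)

  on-normaliseʳ : TwoLocal → ∀ {v w} → E v w → ∃ λ c → On (pg v w) c w
  on-normaliseʳ local e with on-normaliseˡ local (E-sym e)
  ... | c , on = c , subst (λ k → On k c _) (pg-sym (E-sym e)) on

-- Four pairwise adjacent vertices with two pages each.

module FourClique (Λ : Layout) (local : Layout.TwoLocal Λ) where
  open Layout Λ

  -- Five units on an edge force this relation on its ends. The contradiction will be that no four
  -- vertices are pairwise so related.
  R : V → V → Set
  R u v = E u v × ¬ Twin u v

  R-sym : ∀ {u v} → R u v → R v u
  R-sym (e , ¬tw) = E-sym e , λ where (a , c , v , u) → ¬tw (a , c , u , v)

  record Clique (a b c d : V) : Set where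
    constructor clique
    field
      ab : R a b
      ac : R a c
      ad : R a d
      bc : R b c
      bd : R b d
      cd : R c d

  swap₁₂ : ∀ {a b c d} → Clique a b c d → Clique b a c d
  swap₁₂ (clique ab ac ad bc bd cd) = clique (R-sym ab) bc bd ac ad cd

  swap₂₃ : ∀ {a b c d} → Clique a b c d → Clique a c b d
  swap₂₃ (clique ab ac ad bc bd cd) = clique ac ab ad (R-sym bc) cd bd

  swap₃₄ : ∀ {a b c d} → Clique a b c d → Clique a b d c
  swap₃₄ (clique ab ac ad bc bd cd) = clique ab ad ac bd bc (R-sym cd)

  -- The page of `uv` lies in both pairs, and it cannot be `α` and `β` at once.
  on-meet : ∀ {α β γ δ u v} → α ≢ β → E u v → On α γ u → On β δ v →
            γ ≡ β ⊎ δ ≡ α ⊎ γ ≡ δ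
  on-meet α≢β e onu onv with onu e | on-sym onv (E-sym e)
  ... | inj₁ p | inj₁ q = contradiction (trans (sym p) q) α≢β
  ... | inj₁ p | inj₂ q = inj₂ (inj₁ (trans (sym q) p))
  ... | inj₂ p | inj₁ q = inj₁ (trans (sym p) q)
  ... | inj₂ p | inj₂ q = inj₂ (inj₂ (trans (sym p) q))

  -- a and c have an edge on page α, b and d one on page β.
  module Square {α β γa γb γc γd a b c d} (α≢β : α ≢ β) (C : Clique a b c d)
                (ona : On α γa a) (onb : On β γb b) (onc : On α γc c) (ond : On β γd d) where
    open Clique C

    -- Otherwise `a` has the pair `α`, `β`. Unless `a` has a twin, the edges `bc` and `cd` give
    -- `γc ≡ γb` and `γc ≡ γd`, and then `b` and `d` are twins.
    γa≢β : γa ≢ β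
    γa≢β refl with on-meet α≢β (E-sym (proj₁ bc)) onc onb | on-meet α≢β (proj₁ cd) onc ond
    ... | inj₁ refl        | _                = proj₂ ac (_ , _ , ona , onc)
    ... | inj₂ (inj₁ refl) | _                = proj₂ ab (_ , _ , ona , λ e → swap (onb e))
    ... | _                | inj₁ refl        = proj₂ ac (_ , _ , ona , onc)
    ... | _                | inj₂ (inj₁ refl) = proj₂ ad (_ , _ , ona , λ e → swap (ond e))
    ... | inj₂ (inj₂ refl) | inj₂ (inj₂ refl) = proj₂ bd (_ , _ , onb , ond)

    -- Otherwise `b` has the pair `α`, `β`. By `γa≢β`, and unless `b` has a twin, the edges `ad` and
    -- `cd` give `γa ≡ γd` and `γc ≡ γd`, and then `a` and `c` are twins.
    γb≢α : γb ≢ α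
    γb≢α refl with on-meet α≢β (proj₁ ad) ona ond | on-meet α≢β (proj₁ cd) onc ond
    ... | inj₁ refl        | _                = γa≢β refl
    ... | inj₂ (inj₁ refl) | _                = proj₂ bd (_ , _ , onb , ond)
    ... | _                | inj₁ refl        = proj₂ bc (_ , _ , (λ e → swap (onb e)) , onc)
    ... | _                | inj₂ (inj₁ refl) = proj₂ bd (_ , _ , onb , ond)
    ... | inj₂ (inj₂ refl) | inj₂ (inj₂ refl) = proj₂ ac (_ , _ , ona , onc)

  -- The square leaves open only that `γa` equals both `γb` and `γd`, and then `b` and `d` are
  -- twins.
  crossing-pages : ∀ {a b c d} → Clique a b c d → pg a c ≢ pg b d → ⊥
  crossing-pages C ac≢bd
    with on-normaliseˡ local (proj₁ (Clique.ac C)) | on-normaliseˡ local (proj₁ (Clique.bd C))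
       | on-normaliseʳ local (proj₁ (Clique.ac C)) | on-normaliseʳ local (proj₁ (Clique.bd C))
  ... | _ , ona | _ , onb | _ , onc | _ , ond
    with on-meet ac≢bd (proj₁ (Clique.ab C)) ona onb | on-meet ac≢bd (proj₁ (Clique.ad C)) ona ond
  ... | inj₁ eq          | _                = Square.γa≢β ac≢bd C ona onb onc ond eq
  ... | inj₂ (inj₁ eq)   | _                = Square.γb≢α ac≢bd C ona onb onc ond eq
  ... | _                | inj₁ eq          = Square.γa≢β ac≢bd C ona onb onc ond eq
  -- The three transpositions together exchange `b` and `d`.
  ... | _                | inj₂ (inj₁ eq)   =
    Square.γb≢α ac≢bd (swap₃₄ (swap₂₃ (swap₃₄ C))) ona ond onc onb eq
  ... | inj₂ (inj₂ refl) | inj₂ (inj₂ refl) = proj₂ (Clique.bd C) (_ , _ , onb , ond)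

  key-split : ∀ {u v} → R u v → key u < key v ⊎ key v < key u
  key-split {u} {v} (e , _) with <-cmp (key u) (key v)
  ... | tri< lt _ _ = inj₁ lt
  ... | tri≈ _ eq _ = contradiction (key-inj eq) (E⇒≢ e)
  ... | tri> _ _ gt = inj₂ gt

  -- In the order `a`, `b`, `c`, `d` the edges `ac` and `bd` cross. The lemmas below reach this
  -- order by insertion, as `Clique` is symmetric in its four vertices.
  sorted⁴ : ∀ {a b c d} → key a < key b → key b < key c → key c < key d → Clique a b c d → ⊥
  sorted⁴ a<b b<c c<d C = crossing-pages C (cross a<b b<c c<d (proj₁ ac) (proj₁ bd))
    where open Clique C

  sorted³ : ∀ {a b c d} → key a < key b → key b < key c → Clique a b c d → ⊥
  sorted³ a<b b<c C with key-split (Clique.cd C) | key-split (Clique.bd C) | key-split (Clique.ad C)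
  ... | inj₁ c<d | _        | _        = sorted⁴ a<b b<c c<d C
  ... | inj₂ d<c | inj₁ b<d | _        = sorted⁴ a<b b<d d<c (swap₃₄ C)
  ... | inj₂ _   | inj₂ d<b | inj₁ a<d = sorted⁴ a<d d<b b<c (swap₂₃ (swap₃₄ C))
  ... | inj₂ _   | inj₂ _   | inj₂ d<a = sorted⁴ d<a a<b b<c (swap₁₂ (swap₂₃ (swap₃₄ C)))

  sorted² : ∀ {a b c d} → key a < key b → Clique a b c d → ⊥
  sorted² a<b C with key-split (Clique.bc C) | key-split (Clique.ac C)
  ... | inj₁ b<c | _        = sorted³ a<b b<c C
  ... | inj₂ c<b | inj₁ a<c = sorted³ a<c c<b (swap₂₃ C)
  ... | inj₂ _   | inj₂ c<a = sorted³ c<a a<b (swap₁₂ (swap₂₃ C))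

  ¬clique : ∀ {a b c d} → Clique a b c d → ⊥
  ¬clique C with key-split (Clique.ab C)
  ... | inj₁ a<b = sorted² a<b C
  ... | inj₂ b<a = sorted² b<a (swap₁₂ C)

-- One unit on an arc between p and q.

record Unit {V : Set} (E : V → V → Set) (p q x y s t : V) : Set where
  field
    px : E p x
    py : E p y
    ps : E p s
    qx : E q x
    qy : E q y
    qt : E q t
    xy : E x y
    xs : E x s
    xt : E x t
    ys : E y s
    yt : E y t

module Arc (Λ : Layout) (local : Layout.TwoLocal Λ) where
  open Layout Λ

  -- The spine is rotated so that `p` comes first. The arc in question then consists of the keys
  -- below that of `q`.
  module _ {p q a c} (onp : On a c p) (onq : On a c q) (p-first : ∀ {v} → v ≢ p → key p < key v) where

    after-p : ∀ {z} → E p z → key p < key z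
    after-p e = p-first (≢-sym (E⇒≢ e))

    -- The order is `p`, `z`, `z′`, `q`, so the two edges cross.
    fans-differ : ∀ {z z′} → E q z → E p z′ → E p z → key z < key z′ → key z′ < key q →
                  pg p z′ ≢ pg z q
    fans-differ qz pz′ pz z<z′ z′<q = cross (after-p pz) z<z′ z′<q pz′ (E-sym qz)

    module _ {z z′} (pz : E p z) (qz : E q z) (pz′ : E p z′) (qz′ : E q z′) where

      module _ {x} (px : E p x) (qx : E q x) (z<x : key z < key x) (x<z′ : key x < key z′) (z′<q : key z′ < key q) where

        -- Both `px` and `pz′` avoid the page of `zq`, so they share the other page; but `pz′`
        -- crosses `xq`.
        inner-fans-differ : pg p x ≢ pg x q
        inner-fans-differ eq = fans-differ qx pz′ px x<z′ z′<q
          (trans (sym (pair-squeeze (on-sym onq qz) (onp px) (onp pz′)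
                   (≢-sym (fans-differ qz px pz z<x (<-trans x<z′ z′<q)))
                   (≢-sym (fans-differ qz pz′ pz (<-trans z<x x<z′) z′<q))))
                 eq)

        -- By `inner-fans-differ` the edges from `x` to `p` and `q` already use up the two pages of
        -- `x`.
        inner-on : On a c x
        inner-on = on-absorb local (E-sym px) (E-sym qx)
          (λ eq → inner-fans-differ (trans (pg-sym px) eq))
          (on-sym onp px) (on-sym onq qx)

        -- The edge `xy` would cross both `pz′` and `zq`, which lie on different pages and so block
        -- both pages open to `x`.
        inner-¬escape : ∀ {y} → E x y → key q < key y → ⊥
        inner-¬escape xy q<y =
          fans-differ qz pz′ pz (<-trans z<x x<z′) z′<q
            (pair-squeeze (inner-on xy) (onp pz′) (on-sym onq qz)
              (≢-sym (cross (after-p px) x<z′ (<-trans z′<q q<y) pz′ xy))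
              (≢-sym (cross z<x (<-trans x<z′ z′<q) q<y (E-sym qz) xy)))

      module _ {x y s t} (U : Unit E p q x y s t) (z<x : key z < key x) (x<y : key x < key y)
               (y<z′ : key y < key z′) (z′<q : key z′ < key q) where
        open Unit U

        private
          y<q = <-trans y<z′ z′<q
          x<q = <-trans x<y y<q
          onx = inner-on px qx z<x (<-trans x<y y<z′) z′<q
          ony = inner-on py qy (<-trans z<x x<y) y<z′ z′<q

        -- If `w` came before `x`, then `yw` would cross `px` and `qx`; if it came between `y` and
        -- `q`, then `xw` would cross `py` and `qy`. Either way `inner-fans-differ` leaves no page.
        -- Beyond `q`, the edge `xw` would escape.
        apex-between : ∀ {w} → E x w → E y w → w ≢ p → w ≢ q → key x < key w × key w < key y
        apex-between {w} xw yw w≢p w≢q with <-cmp (key x) (key w) | <-cmp (key w) (key y) | <-cmp (key w) (key q)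
        ... | tri≈ _ eq _  | _            | _            = contradiction (key-inj eq) (E⇒≢ xw)
        ... | _            | tri≈ _ eq _  | _            = contradiction (key-inj (sym eq)) (E⇒≢ yw)
        ... | _            | _            | tri≈ _ eq _  = contradiction (key-inj eq) w≢q
        ... | tri< x<w _ _ | tri< w<y _ _ | _            = x<w , w<y
        ... | tri> _ _ w<x | _            | _            =
          contradiction
            (pair-squeeze (ony yw) (onp px) (on-sym onq qx)
              (λ eq → cross (p-first w≢p) w<x x<y px (E-sym yw) (trans (sym eq) (pg-sym yw)))
              (λ eq → cross w<x x<y y<q (E-sym yw) (E-sym qx) (trans (sym (pg-sym yw)) eq)))
            (inner-fans-differ px qx z<x (<-trans x<y y<z′) z′<q)
        ... | tri< x<w _ _ | tri> _ _ y<w | tri< w<q _ _ =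
          contradiction
            (pair-squeeze (onx xw) (onp py) (on-sym onq qy)
              (≢-sym (cross (after-p px) x<y y<w py xw))
              (cross x<y y<w w<q xw (E-sym qy)))
            (inner-fans-differ py qy (<-trans z<x x<y) y<z′ z′<q)
        ... | _            | _            | tri> _ _ q<w = contradiction q<w (inner-¬escape px qx z<x (<-trans x<y y<z′) z′<q xw)

        -- If s < t then xt and ys cross, ps crosses xy and xt, and qt crosses xy and ys,
        -- so with two pages both xt and ys are on the page of xy. If t < s, exchange s and t.
        ¬inner-unit : s ≢ q → t ≢ p → s ≢ t → ⊥
        ¬inner-unit s≢q t≢p s≢t with apex-between xs ys (≢-sym (E⇒≢ ps)) s≢q | apex-between xt yt t≢p (≢-sym (E⇒≢ qt))
        ... | x<s , s<y | x<t , t<y with <-cmp (key s) (key t)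
        ...   | tri≈ _ eq _  = s≢t (key-inj eq)
        ...   | tri< s<t _ _ =
          cross x<s s<t t<y xt (E-sym ys)
            (trans (sym (pair-squeeze (onp ps) (onx xy) (onx xt)
                     (cross (after-p px) x<s s<y ps xy)
                     (cross (after-p px) x<s s<t ps xt)))
                   (pair-squeeze (on-sym onq qt) (onx xy) (on-sym ony ys)
                     (≢-sym (cross x<t t<y y<q xy (E-sym qt)))
                     (≢-sym (cross s<t t<y y<q (E-sym ys) (E-sym qt)))))
        ...   | tri> _ _ t<s =
          cross x<t t<s s<y xs (E-sym yt)
            (trans (sym (pair-squeeze (on-sym onq qt) (onx xy) (onx xs)
                     (≢-sym (cross x<t t<y y<q xy (E-sym qt)))
                     (≢-sym (cross x<t t<s (<-trans s<y y<q) xs (E-sym qt)))))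
                   (pair-squeeze (onp ps) (onx xy) (on-sym ony yt)
                     (cross (after-p px) x<s s<y ps xy)
                     (cross (p-first t≢p) t<s s<y ps (E-sym yt))))

-- Families of units and their extreme vertices on an arc.

unit-swapˣʸ : ∀ {V : Set} {E : V → V → Set} {p q x y s t} → (∀ {u v} → E u v → E v u) →
              Unit E p q x y s t → Unit E p q y x s t
unit-swapˣʸ E-sym U = record
  { px = py ; py = px ; ps = ps ; qx = qy ; qy = qx ; qt = qt ; xy = E-sym xy ; xs = ys ; xt = yt ; ys = xs ; yt = xt }
  where open Unit U

unit-swapᵖᑫ : ∀ {V : Set} {E : V → V → Set} {p q x y s t} → Unit E p q x y s t → Unit E q p x y t s
unit-swapᵖᑫ U = record
  { px = qx ; py = qy ; ps = qt ; qx = px ; qy = py ; qt = ps ; xy = xy ; xs = xt ; xt = xs ; ys = yt ; yt = ys }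
  where open Unit U

-- A Boolean selects `x` or `y`, so that these vertices of all units form one family. `xy-inj`
-- separates different units; within a unit `x` and `y` differ because they are adjacent.
record Units {V : Set} (E : V → V → Set) (p q : V) (m : ℕ) : Set where
  field
    xy-of  : Fin m → Bool → V
    s-of   : Fin m → V
    t-of   : Fin m → V
    unit   : ∀ i → Unit E p q (xy-of i false) (xy-of i true) (s-of i) (t-of i)
    s≢q    : ∀ i → s-of i ≢ q
    t≢p    : ∀ i → t-of i ≢ p
    s≢t    : ∀ i → s-of i ≢ t-of i
    xy-inj : ∀ {i j} b b′ → xy-of i b ≡ xy-of j b′ → i ≡ j

  p-sees : ∀ i b → E p (xy-of i b)
  p-sees i false = Unit.px (unit i)
  p-sees i true  = Unit.py (unit i)

  q-sees : ∀ i b → E q (xy-of i b)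
  q-sees i false = Unit.qx (unit i)
  q-sees i true  = Unit.qy (unit i)

units-swapᵖᑫ : ∀ {V : Set} {E : V → V → Set} {p q m} → Units E p q m → Units E q p m
units-swapᵖᑫ U = record
  { xy-of = xy-of ; s-of = t-of ; t-of = s-of ; unit = λ i → unit-swapᵖᑫ (unit i)
  ; s≢q = t≢p ; t≢p = s≢q ; s≢t = λ i → ≢-sym (s≢t i) ; xy-inj = xy-inj }
  where open Units U

any²? : ∀ {m} {P : Fin m → Bool → Set} → (∀ i b → Dec (P i b)) → Dec (∃₂ P)
any²? P? = map′
  (λ { (i , inj₁ h) → i , false , h ; (i , inj₂ h) → i , true , h })
  (λ { (i , false , h) → i , inj₁ h ; (i , true , h) → i , inj₂ h })
  (anyFin? λ i → P? i false ⊎-dec P? i true)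

module Extremes (Λ : Layout) (local : Layout.TwoLocal Λ) where
  open Layout Λ
  open Arc Λ local

  module _ {p q m} (U : Units E p q m) where
    open Units U

    private
      k : Fin m → Bool → ℕ
      k i b = key (xy-of i b)

    -- Vertices beyond `q` may take part in the minimum, as they exceed it anyway, but have to be
    -- left out of the maximum.
    First Last : Fin m → Bool → Set
    First i b = k i b < key q × (∀ j b′ → k i b ≤ k j b′)
    Last  i b = k i b < key q × (∀ j b′ → k j b′ < key q → k j b′ ≤ k i b)

    first-unique : ∀ {i j b b′} → First i b → First j b′ → i ≡ j
    first-unique {i} {j} {b} {b′} (_ , i≤) (_ , j≤) =
      xy-inj b b′ (key-inj (≤-antisym (i≤ j b′) (j≤ i b)))

    last-unique : ∀ {i j b b′} → Last i b → Last j b′ → i ≡ j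
    last-unique {i} {j} {b} {b′} (i< , ≤i) (j< , ≤j) =
      xy-inj b b′ (key-inj (≤-antisym (≤j i b i<) (≤i j b′ j<)))

    first-or-below : ∀ {i b} → k i b < key q → First i b ⊎ ∃₂ λ j b′ → k j b′ < k i b
    first-or-below {i} {b} i<q with any²? (λ j b′ → k j b′ <? k i b)
    ... | yes (j , b′ , lt) = inj₂ (j , b′ , lt)
    ... | no ¬lt            = inj₁ (i<q , λ j b′ → ≮⇒≥ λ lt → ¬lt (j , b′ , lt))

    last-or-above : ∀ {i b} → k i b < key q → Last i b ⊎ ∃₂ λ j b′ → k i b < k j b′ × k j b′ < key q
    last-or-above {i} {b} i<q with any²? (λ j b′ → (k i b <? k j b′) ×-dec (k j b′ <? key q))
    ... | yes (j , b′ , lt) = inj₂ (j , b′ , lt)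
    ... | no ¬lt            = inj₁ (i<q , λ j b′ j<q → ≮⇒≥ λ lt → ¬lt (j , b′ , lt , j<q))

    module _ {a c} (onp : On a c p) (onq : On a c q) (p-first : ∀ {v} → v ≢ p → key p < key v) where

      -- Otherwise some `z` before the pair and some `z′` after it surround both vertices, which
      -- `¬inner-unit` excludes. The Booleans are free so that either of `x` and `y` may come first.
      extreme-in-pair : ∀ {i b b′} → Unit E p q (xy-of i b) (xy-of i b′) (s-of i) (t-of i) →
                        k i b < k i b′ → k i b′ < key q → First i b ⊎ Last i b′
      extreme-in-pair {i} V x<y y<q with first-or-below (<-trans x<y y<q) | last-or-above y<q
      ... | inj₁ first         | _                             = inj₁ first
      ... | inj₂ _             | inj₁ last                     = inj₂ last
      ... | inj₂ (j , d , z<x) | inj₂ (j′ , d′ , y<z′ , z′<q) =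
        contradiction (s≢t i)
          (¬inner-unit onp onq p-first (p-sees j d) (q-sees j d) (p-sees j′ d′) (q-sees j′ d′) V z<x x<y y<z′ z′<q (s≢q i) (t≢p i))

      extreme-of-unit : ∀ i → k i false < key q → ∃ λ b → First i b ⊎ Last i b
      extreme-of-unit i x<q with <-cmp (k i false) (k i true) | <-cmp (k i true) (key q)
      ... | tri≈ _ eq _  | _            = contradiction (key-inj eq) (E⇒≢ (Unit.xy (unit i)))
      ... | _            | tri≈ _ eq _  = contradiction (key-inj (sym eq)) (E⇒≢ (q-sees i true))
      ... | tri< x<y _ _ | tri< y<q _ _ with extreme-in-pair (unit i) x<y y<q
      ...   | inj₁ first = false , inj₁ first
      ...   | inj₂ last  = true , inj₂ last
      extreme-of-unit i x<q
          | tri> _ _ y<x | tri< _ _ _   with extreme-in-pair (unit-swapˣʸ E-sym (unit i)) y<x x<q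
      ...   | inj₁ first = true , inj₁ first
      ...   | inj₂ last  = false , inj₂ last
      -- With `y` on the other arc, the edge `xy` leaves this one, so `x` cannot be surrounded and
      -- is itself extreme.
      extreme-of-unit i x<q
          | _            | tri> _ _ q<y with first-or-below x<q | last-or-above x<q
      ...   | inj₁ first         | _                             = false , inj₁ first
      ...   | inj₂ _             | inj₁ last                     = false , inj₂ last
      ...   | inj₂ (j , d , z<x) | inj₂ (j′ , d′ , x<z′ , z′<q) =
        contradiction q<y (inner-¬escape onp onq p-first (p-sees j d) (q-sees j d) (p-sees j′ d′) (q-sees j′ d′)
          (Unit.px (unit i)) (Unit.qx (unit i)) z<x x<z′ z′<q (Unit.xy (unit i)))

-- Rotating the spine to start at a given vertex.

module Rotation (Λ : Layout) (N : ℕ) (key<N : ∀ v → Layout.key Λ v < N) where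
  open Layout Λ

  stays≢wraps : ∀ {u v} → key v ≢ key u + N
  stays≢wraps {u} {v} = <⇒≢ (<-≤-trans (key<N v) (m≤n+m N (key u)))

  wraps≮stays : ∀ {u v} → ¬ key u + N < key v
  wraps≮stays {u} {v} lt = <-asym lt (<-≤-trans (key<N v) (m≤n+m N (key u)))

  module _ (p : V) where

    -- The new key is an index, so that a match on `turn v` replaces `turned-key v` by its value and
    -- gives the reason for it.
    data Turned (v : V) : ℕ → Set where
      stays : key p ≤ key v → Turned v (key v)
      wraps : key v < key p → Turned v (key v + N)

    turn : ∀ v → ∃ (Turned v)
    turn v with key v <? key p
    ... | yes v<p = key v + N , wraps v<p
    ... | no v≮p  = key v , stays (≮⇒≥ v≮p)

    turned-key : V → ℕ
    turned-key v = proj₁ (turn v)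

    turned-inj : ∀ {u v} → turned-key u ≡ turned-key v → u ≡ v
    turned-inj {u} {v} eq with turn u | turn v
    ... | _ , stays _ | _ , stays _ = key-inj eq
    ... | _ , stays _ | _ , wraps _ = contradiction eq stays≢wraps
    ... | _ , wraps _ | _ , stays _ = contradiction (sym eq) stays≢wraps
    ... | _ , wraps _ | _ , wraps _ = key-inj (+-cancelʳ-≡ N _ _ eq)

    -- Crossing depends only on the cyclic order. The vertices that wrap are last in the new order
    -- and first in the old one, and the ends of the two edges still alternate. The final three
    -- clauses exclude a wrapped vertex before one that stays.
    turned-cross : ∀ {u v x y} → turned-key u < turned-key x → turned-key x < turned-key v →
                   turned-key v < turned-key y → E u v → E x y → pg u v ≢ pg x y
    turned-cross {u} {v} {x} {y} u<x x<v v<y uv xy eq with turn u | turn x | turn v | turn y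
    ... | _ , stays _   | _ , stays _   | _ , stays _   | _ , stays _   = cross u<x x<v v<y uv xy eq
    ... | _ , stays p≤u | _ , stays _   | _ , stays _   | _ , wraps y<p =
      cross (<-≤-trans y<p p≤u) u<x x<v (E-sym xy) uv (trans (sym (pg-sym xy)) (sym eq))
    ... | _ , stays p≤u | _ , stays _   | _ , wraps _   | _ , wraps y<p =
      cross (+-cancelʳ-< N _ _ v<y) (<-≤-trans y<p p≤u) u<x (E-sym uv) (E-sym xy)
        (trans (sym (pg-sym uv)) (trans eq (pg-sym xy)))
    ... | _ , stays p≤u | _ , wraps _   | _ , wraps _   | _ , wraps y<p =
      cross (+-cancelʳ-< N _ _ x<v) (+-cancelʳ-< N _ _ v<y) (<-≤-trans y<p p≤u) xy (E-sym uv)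
        (trans (sym eq) (pg-sym uv))
    ... | _ , wraps _   | _ , wraps _   | _ , wraps _   | _ , wraps _   =
      cross (+-cancelʳ-< N _ _ u<x) (+-cancelʳ-< N _ _ x<v) (+-cancelʳ-< N _ _ v<y) uv xy eq
    ... | _ , wraps _   | _ , stays _   | _             | _             = wraps≮stays u<x
    ... | _             | _ , wraps _   | _ , stays _   | _             = wraps≮stays x<v
    ... | _             | _             | _ , wraps _   | _ , stays _   = wraps≮stays v<y

    turned-first : ∀ {v} → v ≢ p → turned-key p < turned-key v
    turned-first {v} v≢p with turn p | turn v
    ... | _ , wraps p<p | _             = contradiction p<p (<-irrefl refl)
    ... | _ , stays _   | _ , stays p≤v = ≤∧≢⇒< p≤v λ eq → v≢p (sym (key-inj eq))
    ... | _ , stays _   | _ , wraps _   = <-≤-trans (key<N p) (m≤n+m N (key v))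

    rotate : Layout
    rotate = record Λ { key = turned-key ; key-inj = turned-inj ; cross = turned-cross }

  -- A vertex met after `q` on the way round from `p` lies on the arc from `q` back to `p`. This
  -- reduces the second arc to the first with `p` and `q` exchanged.
  beyond-turns-before : ∀ {p q v} → p ≢ q → turned-key p q < turned-key p v → turned-key q v < turned-key q p
  beyond-turns-before {p} {q} {v} p≢q q<v with turn p q | turn p v | turn q v | turn q p
  ... | _             | _             | _ , stays _   | _ , wraps _   = <-≤-trans (key<N v) (m≤n+m N (key p))
  ... | _ , stays p≤q | _             | _             | _ , stays q≤p = contradiction (key-inj (≤-antisym p≤q q≤p)) p≢q
  ... | _ , stays _   | _ , stays _   | _ , wraps v<q | _             = contradiction q<v (<-asym v<q)
  ... | _ , stays _   | _ , wraps v<p | _ , wraps _   | _ , wraps _   = +-monoˡ-< N v<p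
  ... | _ , wraps _   | _ , stays _   | _             | _             = contradiction q<v wraps≮stays
  ... | _ , wraps _   | _ , wraps v<p | _ , stays _   | _ , stays _   = v<p
  ... | _ , wraps _   | _ , wraps _   | _ , wraps v<q | _             = contradiction (+-cancelʳ-< N _ _ q<v) (<-asym v<q)

-- Five units between twins.

module FiveUnits (Λ : Layout) (local : Layout.TwoLocal Λ)
                 (N : ℕ) (key<N : ∀ v → Layout.key Λ v < N) where
  open Layout Λ
  open Rotation Λ N key<N

  module _ {p q a c} (p≢q : p ≢ q) (onp : On a c p) (onq : On a c q) (U : Units E p q 5) where
    open Units U

    private
      module P = Extremes (rotate p) local
      module Q = Extremes (rotate q) local
      U′ = units-swapᵖᑫ U

    -- The four places: first and last on the arc from `p` to `q`, then first and last on the arc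
    -- from `q` round to `p`, read in the rotation that starts at `q`.
    Extreme : Fin 4 → Fin 5 → Set
    Extreme zero                   i = ∃ (P.First U i)
    Extreme (suc zero)             i = ∃ (P.Last U i)
    Extreme (suc (suc zero))       i = ∃ (Q.First U′ i)
    Extreme (suc (suc (suc zero))) i = ∃ (Q.Last U′ i)

    extreme-unique : ∀ κ {i j} → Extreme κ i → Extreme κ j → i ≡ j
    extreme-unique zero                   (_ , h) (_ , h′) = P.first-unique U h h′
    extreme-unique (suc zero)             (_ , h) (_ , h′) = P.last-unique U h h′
    extreme-unique (suc (suc zero))       (_ , h) (_ , h′) = Q.first-unique U′ h h′
    extreme-unique (suc (suc (suc zero))) (_ , h) (_ , h′) = Q.last-unique U′ h h′

    -- The position of `x` alone selects the arc. If `x` lies beyond `q`, the unit is read with `p`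
    -- and `q`, and hence `s` and `t`, exchanged.
    owns-extreme : ∀ i → ∃ λ κ → Extreme κ i
    owns-extreme i with <-cmp (turned-key p (xy-of i false)) (turned-key p q)
    ... | tri≈ _ eq _ = contradiction (sym (turned-inj p eq)) (E⇒≢ (q-sees i false))
    ... | tri< x<q _ _ with P.extreme-of-unit U onp onq (turned-first p) i x<q
    ...   | b , inj₁ h = zero , b , h
    ...   | b , inj₂ h = suc zero , b , h
    owns-extreme i | tri> _ _ q<x
      with Q.extreme-of-unit U′ onq onp (turned-first q) i (beyond-turns-before p≢q q<x)
    ...   | b , inj₁ h = suc (suc zero) , b , h
    ...   | b , inj₂ h = suc (suc (suc zero)) , b , h

    ¬five-units : ⊥
    ¬five-units with pigeonhole (s≤s (s≤s (s≤s (s≤s (s≤s z≤n))))) (λ i → proj₁ (owns-extreme i))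
    ... | i , j , i<j , eq = <ᶠ⇒≢ i<j
      (extreme-unique (proj₁ (owns-extreme j)) (subst (λ κ → Extreme κ i) eq (proj₂ (owns-extreme i))) (proj₂ (owns-extreme j)))

-- Book embeddings as layouts.

module _ {G : Graph} (L : LinearEmbedding G) (book : IsBookEmbedding L) where

  layout : Layout
  layout = record
    { V        = Fin (n G)
    ; E        = Edge G
    ; E-sym    = λ {u} {v} → subst T (Graph.sym G u v)
    ; E-irrefl = λ {v} → subst T (irrefl G v)
    ; pg       = page L
    ; pg-sym   = λ {u} {v} → page-sym L u v
    ; key      = λ v → toℕ (pos L v)
    ; key-inj  = λ eq → pos-inj L (toℕ-injective eq)
    ; cross    = λ u<x x<v v<y uv xy → book _ _ _ _ uv xy (u<x , x<v , v<y)
    }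

  two-local : ∀ {j} → j ≤ 2 → IsLocal L j → Layout.TwoLocal layout
  two-local j≤2 local v with local v
  -- Short lists are padded to a pair: without pages there are no edges, so 0 serves as a default,
  -- and a single page is taken twice.
  ... | []                , _  , mem = 0 , 0 , λ e → contradiction (mem _ e) λ ()
  ... | a ∷ []            , _  , mem = a , a , λ e → case₁ (mem _ e)
    where
    case₁ : ∀ {k} → k ∈ a ∷ [] → k ∈⟨ a , a ⟩
    case₁ (here eq) = inj₁ eq
  ... | a ∷ c ∷ []        , _  , mem = a , c , λ e → case₂ (mem _ e)
    where
    case₂ : ∀ {k} → k ∈ a ∷ c ∷ [] → k ∈⟨ a , c ⟩
    case₂ (here eq)         = inj₁ eq
    case₂ (there (here eq)) = inj₂ eq
  ... | _ ∷ _ ∷ _ ∷ _     , le , _   = contradiction (≤-trans le j≤2) λ { (s≤s (s≤s ())) }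

-- The graph and its vertex numbering.

Code : ℕ → ℕ → ℕ → ℕ → Set
Code a b c d = Fin a ⊎ ((Fin b × Fin c) × Fin d)

module _ {a b c d : ℕ} where

  decode : Fin (a + b * c * d) → Code a b c d
  decode = map₂ (map₁ (remQuot c) ∘ remQuot d) ∘ splitAt a

  -- The first summand comes first and the triples follow lexicographically, so this numbering is
  -- also the spine order for the upper bound.
  encode : Code a b c d → Fin (a + b * c * d)
  encode = join a (b * c * d) ∘ map₂ λ (u , r) → combine (uncurry combine u) r

  decode-encode : ∀ v → decode (encode v) ≡ v
  decode-encode (inj₁ i) = cong (map₂ (map₁ (remQuot c) ∘ remQuot d)) (splitAt-↑ˡ a i (b * c * d))
  decode-encode (inj₂ ((e , k) , r)) = trans
    (cong (map₂ (map₁ (remQuot c) ∘ remQuot d)) (splitAt-↑ʳ a (b * c * d) (combine (combine e k) r)))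
    (cong inj₂ (trans (cong (map₁ (remQuot c)) (remQuot-combine (combine e k) r))
                      (cong (_, r) (remQuot-combine e k))))

  encode-injective : ∀ {u v} → encode u ≡ encode v → u ≡ v
  encode-injective {u} {v} eq = trans (sym (decode-encode u)) (trans (cong decode eq) (decode-encode v))

  encode-decode : ∀ v → encode (decode v) ≡ v
  encode-decode v with splitAt a v in eq
  ... | inj₁ i = trans (cong (join a (b * c * d)) (sym eq)) (join-splitAt a (b * c * d) v)
  ... | inj₂ w = trans
    (cong (λ z → join a (b * c * d) (inj₂ z))
      (trans (cong (λ u → combine u (proj₂ (remQuot {b * c} d w))) (combine-remQuot {b} c (proj₁ (remQuot {b * c} d w))))
             (combine-remQuot {b * c} d w)))
    (trans (cong (join a (b * c * d)) (sym eq)) (join-splitAt a (b * c * d) v))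

  opaque
    -- Opaque, so that the list unfolds only where a finite check is evaluated.
    codes : List (Code a b c d)
    codes = map inj₁ (allFin a) ++ map inj₂ (cartesianProduct (cartesianProduct (allFin b) (allFin c)) (allFin d))

    ∈-codes : ∀ v → v ∈ codes
    ∈-codes (inj₁ i) = ∈-++⁺ˡ (∈-map⁺ inj₁ (∈-allFin i))
    ∈-codes (inj₂ ((e , k) , r)) = ∈-++⁺ʳ (map inj₁ (allFin a))
      (∈-map⁺ inj₂ (∈-cartesianProduct⁺ (∈-cartesianProduct⁺ (∈-allFin e) (∈-allFin k)) (∈-allFin r)))

Vertex : Set
Vertex = Code 4 6 5 4

-- In inner e k r, e is a core edge, k a unit on it, and r = 0, 1, 2, 3 stands for x, s, y, t.
pattern core i      = inj₁ i
pattern inner e k r = inj₂ ((e , k) , r)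

-- The core edges in the order 01, 02, 03, 12, 13, 23, which is the order of the fields of `Clique`.
src tgt : Fin 6 → Fin 4
src 0F = 0F
src 1F = 0F
src 2F = 0F
src 3F = 1F
src 4F = 1F
src 5F = 2F
tgt 0F = 1F
tgt 1F = 2F
tgt 2F = 3F
tgt 3F = 2F
tgt 4F = 3F
tgt 5F = 3F

_==_ : ∀ {m} → Fin m → Fin m → Bool
i == j = does (i ≟ᶠ j)

==-refl : ∀ {m} (i : Fin m) → (i == i) ≡ true
==-refl i = dec-true (i ≟ᶠ i) refl

==-sym : ∀ {m} (i j : Fin m) → (i == j) ≡ (j == i)
==-sym i j = does-⇔ (mk⇔ sym sym) (i ≟ᶠ j) (j ≟ᶠ i)

-- The complete graph on `x`, `s`, `y`, `t` without the edge `st`.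
bonded : Fin 4 → Fin 4 → Bool
bonded 1F 3F = false
bonded 3F 1F = false
bonded r  r′ = not (r == r′)

bonded-sym : ∀ r r′ → bonded r r′ ≡ bonded r′ r
bonded-sym 0F 0F = refl
bonded-sym 0F 1F = refl
bonded-sym 0F 2F = refl
bonded-sym 0F 3F = refl
bonded-sym 1F 0F = refl
bonded-sym 1F 1F = refl
bonded-sym 1F 2F = refl
bonded-sym 1F 3F = refl
bonded-sym 2F 0F = refl
bonded-sym 2F 1F = refl
bonded-sym 2F 2F = refl
bonded-sym 2F 3F = refl
bonded-sym 3F 0F = refl
bonded-sym 3F 1F = refl
bonded-sym 3F 2F = refl
bonded-sym 3F 3F = refl

sees : Fin 4 → Fin 6 → Fin 4 → Bool
sees i e r = ((i == src e) ∧ not (r == 3F)) ∨ ((i == tgt e) ∧ not (r == 1F))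

adjᵛ : Vertex → Vertex → Bool
adjᵛ (core i)      (core j)         = not (i == j)
adjᵛ (core i)      (inner e _ r)    = sees i e r
adjᵛ (inner e _ r) (core i)         = sees i e r
adjᵛ (inner e k r) (inner e′ k′ r′) = (e == e′) ∧ (k == k′) ∧ bonded r r′

adjᵛ-sym : ∀ u v → adjᵛ u v ≡ adjᵛ v u
adjᵛ-sym (core i)      (core j)         = cong not (==-sym i j)
adjᵛ-sym (core i)      (inner e k r)    = refl
adjᵛ-sym (inner e k r) (core i)         = refl
adjᵛ-sym (inner e k r) (inner e′ k′ r′)
  rewrite ==-sym e e′ | ==-sym k k′ | bonded-sym r r′ = refl

bonded-irrefl : ∀ r → bonded r r ≡ false
bonded-irrefl 0F = refl
bonded-irrefl 1F = refl
bonded-irrefl 2F = refl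
bonded-irrefl 3F = refl

adjᵛ-irrefl : ∀ v → adjᵛ v v ≡ false
adjᵛ-irrefl (core i) rewrite ==-refl i = refl
adjᵛ-irrefl (inner e k r) rewrite ==-refl e | ==-refl k = bonded-irrefl r

H : Graph
H = record
  -- 4 core vertices and 6 * 5 * 4 inner ones.
  { n      = 124
  ; adj    = λ u v → adjᵛ (decode u) (decode v)
  ; sym    = λ u v → adjᵛ-sym (decode u) (decode v)
  ; irrefl = λ v → adjᵛ-irrefl (decode v)
  }

vtx : Vertex → Fin 124
vtx = encode

vtx-injective : ∀ u v → vtx u ≡ vtx v → u ≡ v
vtx-injective u v = encode-injective {u = u} {v}

edge : ∀ u v → T (adjᵛ u v) → Edge H (vtx u) (vtx v)
edge u v = subst₂ (λ u′ v′ → T (adjᵛ u′ v′)) (sym (decode-encode u)) (sym (decode-encode v))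

sees-src : ∀ e r → r ≢ 3F → T (sees (src e) e r)
sees-src e r r≢3 rewrite ==-refl (src e) with r ≟ᶠ 3F
... | yes eq = contradiction eq r≢3
... | no _   = tt

sees-tgt : ∀ e r → r ≢ 1F → T (sees (tgt e) e r)
sees-tgt e r r≢1 rewrite ==-refl (tgt e) with r ≟ᶠ 1F
... | yes eq = contradiction eq r≢1
... | no _   = subst T (sym (∨-zeroʳ ((tgt e == src e) ∧ not (r == 3F)))) tt

inner-bond : ∀ e k r r′ → T (bonded r r′) → T (adjᵛ (inner e k r) (inner e k r′))
inner-bond e k r r′ h rewrite ==-refl e | ==-refl k = h

units : ∀ e → Units (Edge H) (vtx (core (src e))) (vtx (core (tgt e))) 5
units e = record
  { xy-of  = λ k b → vtx (inner e k (if b then 2F else 0F))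
  ; s-of   = λ k → vtx (inner e k 1F)
  ; t-of   = λ k → vtx (inner e k 3F)
  ; unit   = λ k → record
    { px = edge (core (src e)) (inner e k 0F) (sees-src e 0F λ ())
    ; py = edge (core (src e)) (inner e k 2F) (sees-src e 2F λ ())
    ; ps = edge (core (src e)) (inner e k 1F) (sees-src e 1F λ ())
    ; qx = edge (core (tgt e)) (inner e k 0F) (sees-tgt e 0F λ ())
    ; qy = edge (core (tgt e)) (inner e k 2F) (sees-tgt e 2F λ ())
    ; qt = edge (core (tgt e)) (inner e k 3F) (sees-tgt e 3F λ ())
    ; xy = edge (inner e k 0F) (inner e k 2F) (inner-bond e k 0F 2F tt)
    ; xs = edge (inner e k 0F) (inner e k 1F) (inner-bond e k 0F 1F tt)
    ; xt = edge (inner e k 0F) (inner e k 3F) (inner-bond e k 0F 3F tt)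
    ; ys = edge (inner e k 2F) (inner e k 1F) (inner-bond e k 2F 1F tt)
    ; yt = edge (inner e k 2F) (inner e k 3F) (inner-bond e k 2F 3F tt)
    }
  ; s≢q    = λ k eq → contradiction (vtx-injective (inner e k 1F) (core (tgt e)) eq) λ ()
  ; t≢p    = λ k eq → contradiction (vtx-injective (inner e k 3F) (core (src e)) eq) λ ()
  ; s≢t    = λ k eq → contradiction (vtx-injective (inner e k 1F) (inner e k 3F) eq) λ ()
  ; xy-inj = λ {k} {k′} b b′ eq → unit-index (vtx-injective (inner e k _) (inner e k′ _) eq)
  }
  where
  unit-index : ∀ {k k′ r r′} → _≡_ {A = Vertex} (inner e k r) (inner e k′ r′) → k ≡ k′
  unit-index refl = refl

src≢tgt : ∀ e → src e ≢ tgt e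
src≢tgt 0F ()
src≢tgt 1F ()
src≢tgt 2F ()
src≢tgt 3F ()
src≢tgt 4F ()
src≢tgt 5F ()

-- The lower bound.

not-two-local : ∀ {j} → HasLocalBookEmbedding H j → 3 ≤ j
not-two-local (L , book , local) = ≮⇒≥ λ { (s≤s j≤2) → refute (two-local L book j≤2 local) }
  where
  Λ = layout L book
  refute : Layout.TwoLocal Λ → ⊥
  -- The five units on a core edge keep its ends from being twins, so all six core edges satisfy
  -- `R`.
  refute local₂ = ¬clique (clique (related 0F) (related 1F) (related 2F) (related 3F) (related 4F) (related 5F))
    where
    open FourClique Λ local₂
    open FiveUnits Λ local₂ 124 (λ v → toℕ<n (pos L v))
    c : Fin 4 → Fin 124
    c i = vtx (core i)
    c-inj : ∀ {i j} → c i ≡ c j → i ≡ j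
    c-inj {i} {j} eq = inj₁-injective (vtx-injective (core i) (core j) eq)
    related : ∀ e → R (c (src e)) (c (tgt e))
    related e = edge (core (src e)) (core (tgt e)) (distinct e)
              , λ where (a , b , onp , onq) → ¬five-units (λ eq → src≢tgt e (c-inj eq)) onp onq (units e)
      where
      distinct : ∀ e → T (not (src e == tgt e))
      distinct 0F = tt
      distinct 1F = tt
      distinct 2F = tt
      distinct 3F = tt
      distinct 4F = tt
      distinct 5F = tt

-- The 3-local book embedding.

rank : Vertex → ℕ
rank v = toℕ (vtx v)

toℕ≡rank : ∀ v → toℕ v ≡ rank (decode v)
toℕ≡rank v = cong toℕ (sym (encode-decode {4} {6} {5} {4} v))

-- Each edge is kept in one direction only, which fixes the orientation in the finite checks below.
ascending : Vertex × Vertex → Bool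
ascending (u , v) = adjᵛ u v ∧ (rank u <ᵇ rank v)

opaque
  arcs : List (Vertex × Vertex)
  arcs = filter (T? ∘ ascending) (cartesianProduct codes codes)

  ∈-arcs : ∀ u v → T (adjᵛ u v) → rank u < rank v → (u , v) ∈ arcs
  ∈-arcs u v e u<v = ∈-filter⁺ (T? ∘ ascending) (∈-cartesianProduct⁺ (∈-codes u) (∈-codes v))
    (Equivalence.from T-∧ (e , <⇒<ᵇ u<v))

all-pairs : ∀ {A : Set} → (A → A → Bool) → List A → Bool
all-pairs check xs = all (λ a → all (check a) xs) xs

-- This turns a check established by evaluation into a statement about arbitrary members of the
-- list.
all-pairs-sound : ∀ {A B : Set} (check : B → B → Bool) (f : A → B) xs → all-pairs check (map f xs) ≡ true →
                  ∀ {a b} → a ∈ xs → b ∈ xs → T (check (f a) (f b))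
all-pairs-sound check f xs h a∈ b∈ =
  lookup (all⁺ (check _) (map f xs) (lookup (all⁺ _ (map f xs) (Equivalence.from T-≡ h)) (∈-map⁺ f a∈))) (∈-map⁺ f b∈)

-- The core edges 02 and 13 cross; 13 is recognised by its product.
pageᵛ : Vertex → Vertex → ℕ
pageᵛ (core i)      (core j)      = if toℕ i * toℕ j ≡ᵇ 3 then 1 else 0
pageᵛ (core i)      (inner _ _ _) = toℕ i
pageᵛ (inner _ _ _) (core i)      = toℕ i
pageᵛ (inner _ _ _) (inner _ _ _) = 4

pageᵛ-sym : ∀ u v → pageᵛ u v ≡ pageᵛ v u
pageᵛ-sym (core i)      (core j)      = cong (λ k → if k ≡ᵇ 3 then 1 else 0) (*-comm (toℕ i) (toℕ j))
pageᵛ-sym (core _)      (inner _ _ _) = refl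
pageᵛ-sym (inner _ _ _) (core _)      = refl
pageᵛ-sym (inner _ _ _) (inner _ _ _) = refl

embedding : LinearEmbedding H
embedding = record
  { pos      = id
  ; pos-inj  = id
  ; page     = λ u v → pageᵛ (decode u) (decode v)
  ; page-sym = λ u v _ → pageᵛ-sym (decode u) (decode v)
  }

arc-info : Vertex × Vertex → ℕ × ℕ × ℕ
arc-info (u , v) = rank u , rank v , pageᵛ u v

uncrossed : ℕ × ℕ × ℕ → ℕ × ℕ × ℕ → Bool
uncrossed (u , v , k) (x , y , l) = not ((u <ᵇ x) ∧ (x <ᵇ v) ∧ (v <ᵇ y) ∧ (k ≡ᵇ l))

opaque
  unfolding arcs codes
  -- By evaluation. The reasons are that edges of one fan share an end, that the core edges on page
  -- 0 or 1 do not cross the fan on that page, and that units occupy disjoint intervals of the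
  -- spine, where in the order `x`, `s`, `y`, `t` only `xy` and the absent `st` would cross.
  uncrossed-on-arcs : all-pairs uncrossed (map arc-info arcs) ≡ true
  uncrossed-on-arcs = refl

pageᵛ-uncrossed : ∀ u v x y → T (adjᵛ u v) → T (adjᵛ x y) →
                  rank u < rank x → rank x < rank v → rank v < rank y → pageᵛ u v ≢ pageᵛ x y
pageᵛ-uncrossed u v x y uv xy u<x x<v v<y eq =
  refute (<⇒<ᵇ u<x) (<⇒<ᵇ x<v) (<⇒<ᵇ v<y) (≡⇒≡ᵇ _ _ eq)
    (all-pairs-sound uncrossed arc-info arcs uncrossed-on-arcs
      (∈-arcs u v uv (<-trans u<x x<v)) (∈-arcs x y xy (<-trans x<v v<y)))
  where
  refute : ∀ {a b c d} → T a → T b → T c → T d → ¬ T (not (a ∧ b ∧ c ∧ d))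
  refute {true} {true} {true} {true} _ _ _ _ ()

embedding-book : IsBookEmbedding embedding
embedding-book u v x y uv xy (u<x , x<v , v<y) =
  pageᵛ-uncrossed (decode u) (decode v) (decode x) (decode y) uv xy
    (ranked u x u<x) (ranked x v x<v) (ranked v y v<y)
  where
  ranked : ∀ a b → toℕ a < toℕ b → rank (decode a) < rank (decode b)
  ranked a b = subst₂ _<_ (toℕ≡rank a) (toℕ≡rank b)

sees⇒end : ∀ i e r → T (sees i e r) → i ≡ src e ⊎ i ≡ tgt e
sees⇒end i e r h with i ≟ᶠ src e | i ≟ᶠ tgt e
... | yes eq | _      = inj₁ eq
... | no _   | yes eq = inj₂ eq

-- A core vertex has its fan page and the two pages of core edges; an inner vertex has the fan pages
-- of the two ends and the page inside units. Repetitions do no harm, as only the length counts.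
pages-at : Vertex → List ℕ
pages-at (core i)      = toℕ i ∷ 0 ∷ 1 ∷ []
pages-at (inner e _ _) = toℕ (src e) ∷ toℕ (tgt e) ∷ 4 ∷ []

page∈pages-at : ∀ v w → T (adjᵛ v w) → pageᵛ v w ∈ pages-at v
page∈pages-at (core i) (core j) _ with toℕ i * toℕ j ≡ᵇ 3
... | true  = there (there (here refl))
... | false = there (here refl)
page∈pages-at (core i)      (inner _ _ _) _ = here refl
page∈pages-at (inner _ _ _) (inner _ _ _) _ = there (there (here refl))
page∈pages-at (inner e _ r) (core i)      h with sees⇒end i e r h
... | inj₁ eq = here (cong toℕ eq)
... | inj₂ eq = there (here (cong toℕ eq))

length-pages-at : ∀ v → length (pages-at v) ≤ 3
length-pages-at (core _)      = ≤-refl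
length-pages-at (inner _ _ _) = ≤-refl

embedding-local : IsLocal embedding 3
embedding-local v = pages-at (decode v) , length-pages-at (decode v) , λ w → page∈pages-at (decode v) (decode w)

local-page-number-3 : LocalPageNumber H 3
local-page-number-3 = (embedding , embedding-book , embedding-local) , λ _ → not-two-local

-- Segments and orientation in the rational plane.

opaque
  -- All vertices get natural coordinates, so that orientations can be decided in ℕ and carried over
  -- to ℚ along this embedding.
  ι : ℕ → ℚ
  ι m = mkℚ (ℤ.+ m) 0 (coprime-sym (1-coprimeTo m))

  ι-+ : ∀ l m → ι (l + m) ≡ ι l ℚ.+ ι m
  ι-+ l m = ℚ.toℚᵘ-injective (ℚᵘ.≃-trans (ℚᵘ.*≡* (cong (ℤ._* ℤ.1ℤ) eq)) (ℚᵘ.≃-sym (ℚ.toℚᵘ-homo-+ (ι l) (ι m))))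
    where
    eq : ℤ.+ (l + m) ≡ ℤ.+ l ℤ.* ℤ.1ℤ ℤ.+ ℤ.+ m ℤ.* ℤ.1ℤ
    eq = trans (ℤ.pos-+ l m) (sym (cong₂ ℤ._+_ (ℤ.*-identityʳ (ℤ.+ l)) (ℤ.*-identityʳ (ℤ.+ m))))

  ι-* : ∀ l m → ι (l * m) ≡ ι l ℚ.* ι m
  ι-* l m = ℚ.toℚᵘ-injective (ℚᵘ.≃-trans (ℚᵘ.*≡* (cong (ℤ._* ℤ.1ℤ) (ℤ.pos-* l m))) (ℚᵘ.≃-sym (ℚ.toℚᵘ-homo-* (ι l) (ι m))))

  ι-< : ∀ {l m} → l < m → ι l ℚ.< ι m
  ι-< {l} {m} l<m = ℚ.*<* (subst₂ ℤ._<_ (sym (ℤ.*-identityʳ (ℤ.+ l))) (sym (ℤ.*-identityʳ (ℤ.+ m))) (ℤ.+<+ l<m))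

  ι-injective : ∀ {l m} → ι l ≡ ι m → l ≡ m
  ι-injective eq = ℤ.+-injective (cong ℚ.numerator eq)

Grid : Set
Grid = ℕ × ℕ

ι² : Grid → Point
ι² (x , y) = ι x , ι y

-- Twice the signed area of the triangle a b c.
area : Point → Point → Point → ℚ
area (ax , ay) (bx , by) (cx , cy) = (bx ℚ.- ax) ℚ.* (cy ℚ.- ay) ℚ.- (by ℚ.- ay) ℚ.* (cx ℚ.- ax)

lerp : Point → Point → ℚ → Point
lerp (ax , ay) (bx , by) t = ax ℚ.+ t ℚ.* (bx ℚ.- ax) , ay ℚ.+ t ℚ.* (by ℚ.- ay)

-- The area is affine in its third point; both criteria for segments below rest on this.
area-lerp : ∀ a b c d t → area a b (lerp c d t) ≡ (1ℚ ℚ.- t) ℚ.* area a b c ℚ.+ t ℚ.* area a b d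
area-lerp (ax , ay) (bx , by) (cx , cy) (dx , dy) t = solve 9
  (λ ax ay bx by cx cy dx dy t →
    (bx :- ax) :* (cy :+ t :* (dy :- cy) :- ay) :- (by :- ay) :* (cx :+ t :* (dx :- cx) :- ax)
    := (con 1ℚ :- t) :* ((bx :- ax) :* (cy :- ay) :- (by :- ay) :* (cx :- ax))
    :+ t :* ((bx :- ax) :* (dy :- ay) :- (by :- ay) :* (dx :- ax)))
  refl ax ay bx by cx cy dx dy t
  where open +-*-Solver

area-abb : ∀ a b → area a b b ≡ 0ℚ
area-abb (ax , ay) (bx , by) = solve 4
  (λ ax ay bx by → (bx :- ax) :* (by :- ay) :- (by :- ay) :* (bx :- ax) := con 0ℚ)
  refl ax ay bx by
  where open +-*-Solver

area-aba : ∀ a b → area a b a ≡ 0ℚ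
area-aba (ax , ay) (bx , by) = solve 4
  (λ ax ay bx by → (bx :- ax) :* (ay :- ay) :- (by :- ay) :* (ax :- ax) := con 0ℚ)
  refl ax ay bx by
  where open +-*-Solver

area-collinear : ∀ a b t → area a b (lerp a b t) ≡ 0ℚ
area-collinear a b t = trans (area-lerp a b a b t)
  (trans (cong₂ (λ r s → (1ℚ ℚ.- t) ℚ.* r ℚ.+ t ℚ.* s) (area-aba a b) (area-abb a b))
         (solve 1 (λ t → (con 1ℚ :- t) :* con 0ℚ :+ t :* con 0ℚ := con 0ℚ) refl t))
  where open +-*-Solver

lerp-reverse : ∀ a b t → lerp a b t ≡ lerp b a (1ℚ ℚ.- t)
lerp-reverse (ax , ay) (bx , by) t = cong₂ _,_ (eq ax bx) (eq ay by)
  where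
  open +-*-Solver
  eq : ∀ x y → x ℚ.+ t ℚ.* (y ℚ.- x) ≡ y ℚ.+ (1ℚ ℚ.- t) ℚ.* (x ℚ.- y)
  eq x y = solve 3 (λ x y t → x :+ t :* (y :- x) := y :+ (con 1ℚ :- t) :* (x :- y)) refl x y t

lerp-0 : ∀ a b → lerp a b 0ℚ ≡ a
lerp-0 (ax , ay) (bx , by) = cong₂ _,_ (eq ax bx) (eq ay by)
  where
  open +-*-Solver
  eq : ∀ x y → x ℚ.+ 0ℚ ℚ.* (y ℚ.- x) ≡ x
  eq x y = solve 2 (λ x y → x :+ con 0ℚ :* (y :- x) := x) refl x y

p≤q⇒0≤q-p : ∀ {p q} → p ℚ.≤ q → 0ℚ ℚ.≤ q ℚ.- p
p≤q⇒0≤q-p {p} {q} p≤q = subst (ℚ._≤ q ℚ.- p) (ℚ.+-inverseʳ p) (ℚ.+-monoˡ-≤ (ℚ.- p) p≤q)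

p<q⇒0<q-p : ∀ {p q} → p ℚ.< q → 0ℚ ℚ.< q ℚ.- p
p<q⇒0<q-p {p} {q} p<q = subst (ℚ._< q ℚ.- p) (ℚ.+-inverseʳ p) (ℚ.+-monoˡ-< (ℚ.- p) p<q)

lerp-on : ∀ a b {t} → 0ℚ ℚ.≤ t → t ℚ.≤ 1ℚ → OnSegment (lerp a b t) a b
lerp-on a b 0≤t t≤1 = _ , 0≤t , t≤1 , refl , refl

on⇒lerp : ∀ {p} a b ((t , _) : OnSegment p a b) → p ≡ lerp a b t
on⇒lerp a b (t , _ , _ , eqx , eqy) = cong₂ _,_ eqx eqy

on-reverse : ∀ {p} a b → OnSegment p a b → OnSegment p b a
on-reverse a b s@(t , 0≤t , t≤1 , _) =
  subst (λ q → OnSegment q b a) (sym (trans (on⇒lerp a b s) (lerp-reverse a b t)))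
    (lerp-on b a (p≤q⇒0≤q-p t≤1)
      (subst (1ℚ ℚ.- t ℚ.≤_) (ℚ.+-identityʳ 1ℚ) (ℚ.+-monoʳ-≤ 1ℚ (ℚ.neg-antimono-≤ 0≤t))))

on-start : ∀ a b → OnSegment a a b
on-start a b = subst (λ q → OnSegment q a b) (lerp-0 a b) (lerp-on a b ℚ.≤-refl (ℚ.nonNegative⁻¹ 1ℚ))

*-pos : ∀ {p q} → 0ℚ ℚ.< p → 0ℚ ℚ.< q → 0ℚ ℚ.< p ℚ.* q
*-pos {p} {q} 0<p 0<q = subst (ℚ._< p ℚ.* q) (ℚ.*-zeroˡ q) (ℚ.*-monoˡ-<-pos q {{ℚ.positive 0<q}} 0<p)

*-nonneg : ∀ {p q} → 0ℚ ℚ.≤ p → 0ℚ ℚ.≤ q → 0ℚ ℚ.≤ p ℚ.* q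
*-nonneg {p} {q} 0≤p 0≤q = subst (ℚ._≤ p ℚ.* q) (ℚ.*-zeroˡ q) (ℚ.*-monoʳ-≤-nonNeg q {{ℚ.nonNegative 0≤q}} 0≤p)

zero-or-pos : ∀ {t} → 0ℚ ℚ.≤ t → t ≡ 0ℚ ⊎ 0ℚ ℚ.< t
zero-or-pos {t} 0≤t with t ℚ.≟ 0ℚ
... | yes eq = inj₁ eq
... | no t≢0 = inj₂ (ℚ.≰⇒> λ t≤0 → t≢0 (ℚ.≤-antisym t≤0 0≤t))

-- The area of `a`, `b`, `p` is 0 because `p` is on `ab`, and it is `s` times a positive number
-- because `p` is on `ad`. So `s` is 0.
fork-meets-at-apex : ∀ {p} a b d → 0ℚ ℚ.< area a b d → OnSegment p a b → OnSegment p a d → p ≡ a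
fork-meets-at-apex a b d 0<abd on on′@(s , 0≤s , _) with zero-or-pos 0≤s
... | inj₁ refl = trans (on⇒lerp a d on′) (lerp-0 a d)
... | inj₂ 0<s  = contradiction 0≡sD (ℚ.<⇒≢ (*-pos 0<s 0<abd))
  where
  open +-*-Solver
  0≡sD : 0ℚ ≡ s ℚ.* area a b d
  0≡sD = trans (sym (area-collinear a b (proj₁ on)))
        (trans (cong (area a b) (trans (sym (on⇒lerp a b on)) (on⇒lerp a d on′)))
        (trans (area-lerp a b a d s)
        (trans (cong (λ r → (1ℚ ℚ.- s) ℚ.* r ℚ.+ s ℚ.* area a b d) (area-aba a b))
               (solve 2 (λ s D → (con 1ℚ :- s) :* con 0ℚ :+ s :* D := s :* D) refl s (area a b d)))))

-- Along `cd` the area over `ab` is a convex combination of two positive numbers, while on `ab` it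
-- vanishes.
same-side⇒disjoint : ∀ {p} a b c d → 0ℚ ℚ.< area a b c → 0ℚ ℚ.< area a b d →
                     OnSegment p a b → OnSegment p c d → ⊥
same-side⇒disjoint a b c d 0<c 0<d on on′@(s , 0≤s , s≤1 , _) =
  ℚ.<⇒≢ (positive (zero-or-pos 0≤s)) (trans (sym (area-collinear a b (proj₁ on)))
    (trans (cong (area a b) (trans (sym (on⇒lerp a b on)) (on⇒lerp c d on′))) (area-lerp a b c d s)))
  where
  open +-*-Solver
  positive : s ≡ 0ℚ ⊎ 0ℚ ℚ.< s → 0ℚ ℚ.< (1ℚ ℚ.- s) ℚ.* area a b c ℚ.+ s ℚ.* area a b d
  positive (inj₁ refl) = subst (0ℚ ℚ.<_)
    (solve 2 (λ C D → C := (con 1ℚ :- con 0ℚ) :* C :+ con 0ℚ :* D) refl (area a b c) (area a b d)) 0<c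
  positive (inj₂ 0<s)  = ℚ.+-mono-≤-< (*-nonneg (p≤q⇒0≤q-p s≤1) (ℚ.<⇒≤ 0<c)) (*-pos 0<s 0<d)

-- area > 0, with both sides moved so that no subtraction occurs.
left : Grid → Grid → Grid → Bool
left (ax , ay) (bx , by) (cx , cy) = (ay * bx + by * cx + cy * ax) <ᵇ (ax * by + bx * cy + cx * ay)

left-sound : ∀ a b c → T (left a b c) → 0ℚ ℚ.< area (ι² a) (ι² b) (ι² c)
left-sound (ax , ay) (bx , by) (cx , cy) h = subst (0ℚ ℚ.<_) eq
  (p<q⇒0<q-p (subst₂ ℚ._<_ (ι-expand ay bx by cx cy ax) (ι-expand ax by bx cy cx ay) (ι-< (<ᵇ⇒< _ _ h))))
  where
  open +-*-Solver
  ι-expand : ∀ k l m n p q → ι (k * l + m * n + p * q) ≡ ι k ℚ.* ι l ℚ.+ ι m ℚ.* ι n ℚ.+ ι p ℚ.* ι q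
  ι-expand k l m n p q = trans (ι-+ (k * l + m * n) (p * q))
    (cong₂ ℚ._+_ (trans (ι-+ (k * l) (m * n)) (cong₂ ℚ._+_ (ι-* k l) (ι-* m n))) (ι-* p q))
  eq = solve 6 (λ ax ay bx by cx cy →
      (ax :* by :+ bx :* cy :+ cx :* ay) :- (ay :* bx :+ by :* cx :+ cy :* ax)
      := (bx :- ax) :* (cy :- ay) :- (by :- ay) :* (cx :- ax))
    refl (ι ax) (ι ay) (ι bx) (ι by) (ι cx) (ι cy)

-- Non-collinearity, as one of the two orientations is positive.
fork : Grid → Grid → Grid → Bool
fork a b d = left a b d ∨ left a d b

fork-sound : ∀ {p} a b d → T (fork a b d) → OnSegment p (ι² a) (ι² b) → OnSegment p (ι² a) (ι² d) → p ≡ ι² a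
fork-sound a b d h on on′ with Equivalence.to T-∨ h
... | inj₁ abd = fork-meets-at-apex (ι² a) (ι² b) (ι² d) (left-sound a b d abd) on on′
... | inj₂ adb = fork-meets-at-apex (ι² a) (ι² d) (ι² b) (left-sound a d b adb) on′ on

-- Both `c` and `d` lie strictly on one side of the line `ab`; exchanging `a` and `b` gives the
-- other side.
apart : Grid → Grid → Grid → Grid → Bool
apart a b c d = left a b c ∧ left a b d ∨ left b a c ∧ left b a d

apart-sound : ∀ {p} a b c d → T (apart a b c d) → OnSegment p (ι² a) (ι² b) → OnSegment p (ι² c) (ι² d) → ⊥
apart-sound a b c d h on on′ with Equivalence.to T-∨ h
... | inj₁ h′ with abc , abd ← Equivalence.to T-∧ h′ =
  same-side⇒disjoint (ι² a) (ι² b) (ι² c) (ι² d) (left-sound a b c abc) (left-sound a b d abd) on on′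
... | inj₂ h′ with bac , bad ← Equivalence.to T-∧ h′ =
  same-side⇒disjoint (ι² b) (ι² a) (ι² c) (ι² d) (left-sound b a c bac) (left-sound b a d bad) (on-reverse (ι² a) (ι² b) on) on′

-- Plane drawings certified by tests on pairs of edges.

Pin : Set
Pin = ℕ × Grid

-- A sufficient test: the edges are equal, or share an end and are not collinear, or one lies
-- strictly beside the line through the other. The test is made on ascending edges, so equal edges
-- agree in direction.
tame : Pin × Pin → Pin × Pin → Bool
tame ((i , a) , (j , b)) ((k , c) , (l , d)) =
  (i ≡ᵇ k) ∧ (j ≡ᵇ l) ∨
  (i ≡ᵇ k) ∧ fork a b d ∨
  (i ≡ᵇ l) ∧ fork a b c ∨
  (j ≡ᵇ k) ∧ fork b a d ∨
  (j ≡ᵇ l) ∧ fork b a c ∨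
  apart a b c d ∨
  apart c d a b

module GridDrawing (G : Graph) (key : Fin (n G) → ℕ) (key-inj : ∀ {u v} → key u ≡ key v → u ≡ v) (at : Fin (n G) → Grid) where

  private
    V = Fin (n G)

  drawing : V → Point
  drawing v = ι² (at v)

  Meeting : V → V → V → V → Point → Set
  Meeting u v x y p =
    ((u ≡ x × v ≡ y) ⊎ (u ≡ y × v ≡ x)) ⊎
    Σ V λ w → (w ≡ u ⊎ w ≡ v) × (w ≡ x ⊎ w ≡ y) × p ≡ drawing w

  meeting-swapˡ : ∀ {u v x y p} → Meeting v u x y p → Meeting u v x y p
  meeting-swapˡ (inj₁ (inj₁ (v≡x , u≡y)))  = inj₁ (inj₂ (u≡y , v≡x))
  meeting-swapˡ (inj₁ (inj₂ (v≡y , u≡x)))  = inj₁ (inj₁ (u≡x , v≡y))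
  meeting-swapˡ (inj₂ (w , ∈vu , ∈xy , eq)) = inj₂ (w , swap ∈vu , ∈xy , eq)

  meeting-swapʳ : ∀ {u v x y p} → Meeting u v y x p → Meeting u v x y p
  meeting-swapʳ (inj₁ same)                = inj₁ (swap same)
  meeting-swapʳ (inj₂ (w , ∈uv , ∈yx , eq)) = inj₂ (w , ∈uv , swap ∈yx , eq)

  tame-sound : ∀ u v x y {p} → T (tame ((key u , at u) , (key v , at v)) ((key x , at x) , (key y , at y))) →
               OnSegment p (ι² (at u)) (ι² (at v)) → OnSegment p (ι² (at x)) (ι² (at y)) → Meeting u v x y p
  tame-sound u v x y {p} h on on′ = cases h
    where
    a = at u
    b = at v
    c = at x
    d = at y
    no′ : OnSegment p (ι² b) (ι² a)
    no′ = on-reverse (ι² a) (ι² b) on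
    no″ : OnSegment p (ι² d) (ι² c)
    no″ = on-reverse (ι² c) (ι² d) on′
    same : ∀ u v → T (key u ≡ᵇ key v) → u ≡ v
    same u v h = key-inj (≡ᵇ⇒≡ (key u) (key v) h)
    cases : _ → Meeting u v x y p
    cases h with Equivalence.to (T-∨ {(key u ≡ᵇ key x) ∧ (key v ≡ᵇ key y)}) h
    ... | inj₁ h₁ with ux , vy ← Equivalence.to T-∧ h₁ = inj₁ (inj₁ (same u x ux , same v y vy))
    ... | inj₂ h₁ with Equivalence.to (T-∨ {(key u ≡ᵇ key x) ∧ fork a b d}) h₁
    ...   | inj₁ h₂ with ux , f ← Equivalence.to T-∧ h₂ =
      inj₂ (u , inj₁ refl , inj₁ (same u x ux) ,
        fork-sound a b d f on (subst (λ w → OnSegment p (ι² (at w)) (ι² d)) (sym (same u x ux)) on′))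
    ...   | inj₂ h₂ with Equivalence.to (T-∨ {(key u ≡ᵇ key y) ∧ fork a b c}) h₂
    ...     | inj₁ h₃ with uy , f ← Equivalence.to T-∧ h₃ =
      inj₂ (u , inj₁ refl , inj₂ (same u y uy) ,
        fork-sound a b c f on (subst (λ w → OnSegment p (ι² (at w)) (ι² c)) (sym (same u y uy)) no″))
    ...     | inj₂ h₃ with Equivalence.to (T-∨ {(key v ≡ᵇ key x) ∧ fork b a d}) h₃
    ...       | inj₁ h₄ with vx , f ← Equivalence.to T-∧ h₄ =
      inj₂ (v , inj₂ refl , inj₁ (same v x vx) ,
        fork-sound b a d f no′ (subst (λ w → OnSegment p (ι² (at w)) (ι² d)) (sym (same v x vx)) on′))
    ...       | inj₂ h₄ with Equivalence.to (T-∨ {(key v ≡ᵇ key y) ∧ fork b a c}) h₄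
    ...         | inj₁ h₅ with vy , f ← Equivalence.to T-∧ h₅ =
      inj₂ (v , inj₂ refl , inj₂ (same v y vy) ,
        fork-sound b a c f no′ (subst (λ w → OnSegment p (ι² (at w)) (ι² c)) (sym (same v y vy)) no″))
    ...         | inj₂ h₅ with Equivalence.to (T-∨ {apart a b c d}) h₅
    ...           | inj₁ h₆ = contradiction on′ (apart-sound a b c d h₆ on)
    ...           | inj₂ h₆ = contradiction on (apart-sound c d a b h₆ on′)

  module _ (tame-edges : ∀ u v x y → Edge G u v → Edge G x y → key u < key v → key x < key y →
                         T (tame ((key u , at u) , (key v , at v)) ((key x , at x) , (key y , at y)))) where

    key-split : ∀ {u v} → Edge G u v → key u < key v ⊎ key v < key u
    key-split {u} {v} e with <-cmp (key u) (key v)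
    ... | tri< lt _ _ = inj₁ lt
    ... | tri> _ _ gt = inj₂ gt
    ... | tri≈ _ eq _ with refl ← key-inj eq = contradiction (subst T (Graph.irrefl G u) e) λ ()

    flip : ∀ {u v} → Edge G u v → Edge G v u
    flip {u} {v} = subst T (Graph.sym G u v)

    ascending-meeting : ∀ u v x y {p} → Edge G u v → Edge G x y → key u < key v → key x < key y →
                        OnSegment p (drawing u) (drawing v) → OnSegment p (drawing x) (drawing y) → Meeting u v x y p
    ascending-meeting u v x y uv xy u<v x<y = tame-sound u v x y (tame-edges u v x y uv xy u<v x<y)

    -- A descending edge is reversed first, which changes neither its segment nor its set of ends.
    meeting : ∀ u v x y {p} → Edge G u v → Edge G x y →
              OnSegment p (drawing u) (drawing v) → OnSegment p (drawing x) (drawing y) → Meeting u v x y p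
    meeting u v x y uv xy on on′ with key-split uv | key-split xy
    ... | inj₁ u<v | inj₁ x<y = ascending-meeting u v x y uv xy u<v x<y on on′
    ... | inj₁ u<v | inj₂ y<x =
      meeting-swapʳ (ascending-meeting u v y x uv (flip xy) u<v y<x on (on-reverse (drawing x) (drawing y) on′))
    ... | inj₂ v<u | inj₁ x<y =
      meeting-swapˡ (ascending-meeting v u x y (flip uv) xy v<u x<y (on-reverse (drawing u) (drawing v) on) on′)
    ... | inj₂ v<u | inj₂ y<x =
      meeting-swapˡ (meeting-swapʳ (ascending-meeting v u y x (flip uv) (flip xy) v<u y<x
        (on-reverse (drawing u) (drawing v) on) (on-reverse (drawing x) (drawing y) on′)))

    module _ (at-inj : ∀ {u v} → at u ≡ at v → u ≡ v) (neighbour : ∀ v → ∃ λ w → Edge G v w) where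

      drawing-injective : ∀ {u v} → drawing u ≡ drawing v → u ≡ v
      drawing-injective eq = at-inj (cong₂ _,_ (ι-injective (cong proj₁ eq)) (ι-injective (cong proj₂ eq)))

      -- Since w has an edge wy, a segment through w meets wy there, so w is one of its ends.
      vertex-on-edge : ∀ u v w → Edge G u v → OnSegment (drawing w) (drawing u) (drawing v) → w ≡ u ⊎ w ≡ v
      vertex-on-edge u v w uv on = end (meeting u v w y {drawing w} uv wy on (on-start (drawing w) (drawing y)))
        where
        y  = proj₁ (neighbour w)
        wy = proj₂ (neighbour w)
        end : Meeting u v w y (drawing w) → w ≡ u ⊎ w ≡ v
        end (inj₁ (inj₁ (u≡w , _)))      = inj₁ (sym u≡w)
        end (inj₁ (inj₂ (_ , v≡w)))      = inj₂ (sym v≡w)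
        end (inj₂ (z , z∈uv , _ , w≡z)) = subst (λ z → z ≡ u ⊎ z ≡ v) (sym (drawing-injective {w} {z} w≡z)) z∈uv

      planar : Planar G
      planar = drawing , drawing-injective , vertex-on-edge , λ u v x y p → meeting u v x y

-- Coordinates for the graph.

corner : Fin 4 → Grid
-- The centroid of the other three corners, so that the core is drawn as a triangle with an inner
-- vertex.
corner 0F = 1 , 1
corner 1F = 0 , 0
corner 2F = 3 , 0
corner 3F = 0 , 3

-- The third corner of the bounded face that receives the units on e. Each of the three bounded
-- faces serves one core edge at vertex 0 and one outer edge.
apex : Fin 6 → Fin 4
apex 0F = 2F
apex 1F = 3F
apex 2F = 1F
apex 3F = 0F
apex 4F = 0F
apex 5F = 0F

-- Barycentric weights, of sum 70, with respect to the corners src e, tgt e and apex e.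
weights : ℕ → Fin 4 → ℕ × ℕ × ℕ
weights k 0F = 39 , 30 ∸ 3 * k , 3 * k + 1
weights k 1F = 40 , 28 ∸ 3 * k , 3 * k + 2
weights k 2F = 38 , 29 ∸ 3 * k , 3 * k + 3
weights k 3F = 36 , 32 ∸ 3 * k , 3 * k + 2

combination : ℕ × ℕ × ℕ → Grid → Grid → Grid → Grid
combination (l , m , n) (ax , ay) (bx , by) (cx , cy) = l * ax + m * bx + n * cx , l * ay + m * by + n * cy

-- Scaling by 70, the sum of the weights, keeps the coordinates natural. The weight of the apex
-- grows from `x` over `s` and `t` to `y` and on to the next unit, so the units are stacked away
-- from the line of their core edge.
place : Vertex → Grid
place (core i)      = 70 * proj₁ (corner i) , 70 * proj₂ (corner i)
place (inner e k r) = combination (weights (toℕ k) r) (corner (src e)) (corner (tgt e)) (corner (apex e))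

pin : Vertex → Pin
pin v = rank v , place v

pin² : Vertex × Vertex → Pin × Pin
pin² (u , v) = pin u , pin v

opaque
  unfolding arcs codes
  -- Planarity comes down to this evaluation over all pairs of edges.
  tame-arcs : all-pairs tame (map pin² arcs) ≡ true
  tame-arcs = refl

distinct : Pin → Pin → Bool
distinct (i , (ax , ay)) (j , (bx , by)) = (i ≡ᵇ j) ∨ not ((ax ≡ᵇ bx) ∧ (ay ≡ᵇ by))

opaque
  unfolding codes
  distinct-codes : all-pairs distinct (map pin codes) ≡ true
  distinct-codes = refl

tame-edges : ∀ u v x y → T (adjᵛ u v) → T (adjᵛ x y) → rank u < rank v → rank x < rank y →
             T (tame (pin² (u , v)) (pin² (x , y)))
tame-edges u v x y uv xy u<v x<y = all-pairs-sound tame pin² arcs tame-arcs (∈-arcs u v uv u<v) (∈-arcs x y xy x<y)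

place-injective : ∀ u v → place u ≡ place v → rank u ≡ rank v
place-injective u v eq
  with Equivalence.to (T-∨ {rank u ≡ᵇ rank v}) (all-pairs-sound distinct pin codes distinct-codes (∈-codes u) (∈-codes v))
... | inj₁ h = ≡ᵇ⇒≡ _ _ h
... | inj₂ h = contradiction h
  (refute (≡⇒≡ᵇ _ _ (cong proj₁ eq)) (≡⇒≡ᵇ _ _ (cong proj₂ eq)))
  where
  refute : ∀ {a b} → T a → T b → ¬ T (not (a ∧ b))
  refute {true} {true} _ _ ()

neighbour : ∀ v → ∃ λ w → T (adjᵛ v w)
neighbour (core 0F)      = core 1F , tt
neighbour (core 1F)      = core 0F , tt
neighbour (core 2F)      = core 0F , tt
neighbour (core 3F)      = core 0F , tt
neighbour (inner e _ 0F) = core (src e) , sees-src e 0F λ ()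
neighbour (inner e _ 1F) = core (src e) , sees-src e 1F λ ()
neighbour (inner e _ 2F) = core (src e) , sees-src e 2F λ ()
neighbour (inner e _ 3F) = core (tgt e) , sees-tgt e 3F λ ()

rank-decode-injective : ∀ {u v} → rank (decode u) ≡ rank (decode v) → u ≡ v
rank-decode-injective {u} {v} eq = toℕ-injective (trans (toℕ≡rank u) (trans eq (sym (toℕ≡rank v))))

H-planar : Planar H
H-planar = planar
  (λ u v x y → tame-edges (decode u) (decode v) (decode x) (decode y))
  (λ {u} {v} eq → rank-decode-injective (place-injective (decode u) (decode v) eq))
  (λ v → let w , vw = neighbour (decode v) in vtx w , subst (λ z → T (adjᵛ (decode v) z)) (sym (decode-encode w)) vw)
  where open GridDrawing H (λ v → rank (decode v)) rank-decode-injective (λ v → place (decode v))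

theorem2 : Σ Graph λ G → Planar G × LocalPageNumber G 3
theorem2 = H , H-planar , local-page-number-3
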